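{- For every integer $n \geq 3$, the graph $G(2n+1, 2n, 2n)$ has a nonorientable quadrangular embedding.
   Context: For nonnegative integers $m,n,k$ with $k \le \min(m,n)$, $G(m,n,k)$ denotes the nearly complete bipartite graph obtained from the complete bipartite graph $K_{m,n}$ (with $m$ white vertices and $n$ black vertices) by deleting $k$ pairwise independent edges (a matching of size $k$). An embedding of a graph in a closed surface is cellular if every face (component of the complement) is an open disk; a quadrangular embedding is a cellular embedding in which every face is bounded by a closed walk of length 4. A nonorientable quadrangular embedding is a quadrangular embedding in a nonorientable closed surface. -}

module Defs where

open import Data.Nat using (ℕ; zero; suc; _+_; _*_; _<_; _≤_)
open import Data.Fin using (Fin; toℕ)
open import Data.Bool using (Bool; true; false; not)
open import Data.Product using (Σ; _×_; _,_)
open import Data.Sum using (_⊎_; inj₁; inj₂)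
open import Relation.Binary.PropositionalEquality using (_≡_; _≢_)
open import Relation.Nullary using (¬_)

-- The nearly complete bipartite graph G(m,n,k).
-- White vertices: Fin m, black vertices: Fin n.  The deleted matching
-- is {(i,i) : i < k} (any matching of size k gives an isomorphic graph).

IsEdge : {m n : ℕ} → ℕ → Fin m → Fin n → Set
IsEdge k i j = ¬ (toℕ i ≡ toℕ j × toℕ i < k)

-- Cellular embeddings in closed surfaces as combinatorial maps
-- (flag / "graph-encoded map" description).
-- A flag is (white end i, black end j, which endpoint e, which side s)
-- of the edge ij:  e = false means the white end, e = true the black end.

Flag : ℕ → ℕ → Set
Flag m n = Fin m × Fin n × Bool × Bool

ValidFlag : {m n : ℕ} → ℕ → Flag m n → Set
ValidFlag k (i , j , _ , _) = IsEdge k i j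

flagVertex : {m n : ℕ} → Flag m n → Fin m ⊎ Fin n
flagVertex (i , j , false , _) = inj₁ i
flagVertex (i , j , true  , _) = inj₂ j

flagEdge : {m n : ℕ} → Flag m n → Fin m × Fin n
flagEdge (i , j , _ , _) = (i , j)

τ₀ : {m n : ℕ} → Flag m n → Flag m n
τ₀ (i , j , e , s) = (i , j , not e , s)

τ₂ : {m n : ℕ} → Flag m n → Flag m n
τ₂ (i , j , e , s) = (i , j , e , not s)

data Reach {m n : ℕ} (ρ : Flag m n → Flag m n) : Flag m n → Flag m n → Set where
  here  : ∀ {f} → Reach ρ f f
  viaρ  : ∀ {f g} → Reach ρ (ρ f) g → Reach ρ f g
  viaτ₂ : ∀ {f g} → Reach ρ (τ₂ f) g → Reach ρ f g

-- A cellular embedding of G(m,n,k) in a closed surface: the remaining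
-- involution τ₁ of the map (τ₀, τ₁, τ₂), which moves to the neighbouring
-- edge in the local rotation at the same vertex.  Vertices of the map are
-- the ⟨τ₁,τ₂⟩-orbits, edges the ⟨τ₀,τ₂⟩-orbits, faces the ⟨τ₀,τ₁⟩-orbits.
record Embedding (m n k : ℕ) : Set where
  field
    τ₁         : Flag m n → Flag m n
    valid      : ∀ f → ValidFlag k f → ValidFlag k (τ₁ f)
    involutive : ∀ f → ValidFlag k f → τ₁ (τ₁ f) ≡ f
    sameVertex : ∀ f → ValidFlag k f → flagVertex (τ₁ f) ≡ flagVertex f
    otherEdge  : ∀ f → ValidFlag k f → flagEdge (τ₁ f) ≢ flagEdge f
    vertexOrbit : ∀ f g → ValidFlag k f → ValidFlag k g →
                  flagVertex f ≡ flagVertex g → Reach τ₁ f g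

open Embedding public

iter : {A : Set} → ℕ → (A → A) → A → A
iter zero    h x = x
iter (suc r) h x = h (iter r h x)

-- one step along a face boundary: τ₁ ∘ τ₀ ; the length of the face
-- (closed walk) containing flag f is the least r ≥ 1 with (τ₁τ₀)^r f = f
faceStep : {m n k : ℕ} → Embedding m n k → Flag m n → Flag m n
faceStep M f = τ₁ M (τ₀ f)

Quadrangular : {m n k : ℕ} → Embedding m n k → Set
Quadrangular {m} {n} {k} M =
  ∀ f → ValidFlag k f →
    iter 4 (faceStep M) f ≡ f ×
    (∀ r → 1 ≤ r → r < 4 → iter r (faceStep M) f ≢ f)

-- the surface is orientable iff the flag graph (edges τ₀,τ₁,τ₂) is bipartite
Orientable : {m n k : ℕ} → Embedding m n k → Set
Orientable {m} {n} {k} M =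
  Σ (Flag m n → Bool) λ c →
    ∀ f → ValidFlag k f →
      (c (τ₀ f) ≢ c f) × (c (τ₁ M f) ≢ c f) × (c (τ₂ f) ≢ c f)

Nonorientable : {m n k : ℕ} → Embedding m n k → Set
Nonorientable M = ¬ Orientable M

{-# OPTIONS --safe #-}

-- Faces are rectangles {w, w′} × {j, j′}, each non-deleted cell (w , j) of the
-- (2n+1) × 2n incidence matrix lying in two of them.  Take the checkerboard of
-- unit squares on the torus ℤ₂ₙ × ℤ₂ₙ with the squares through the diagonal
-- removed, and cover the cells left deficient, together with the extra row ∞, by
-- the rectangles {∞, i} × {i − 1, i + 1}.  All rotations are then cycles, except
-- that the one at ∞ splits by parity into two cycles of length n.  Replacing five
-- rectangles near the origin,
--   {∞,2}×{1,3}, {∞,1}×{0,2}, {2,3}×{0,1}, {4,5}×{0,1}, {4,5}×{2,3},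
-- by
--   {2,4}×{1,3}, {2,5}×{0,1}, {∞,3}×{0,1}, {1,4}×{0,2}, {∞,5}×{2,3},
-- merges the two cycles, keeps all other rotations cyclic, and creates an
-- orientation-reversing closed walk of length nine through the states.

module Submission where

open import Defs
open import Data.Nat using (ℕ; zero; suc; _≤_; _<_; _+_; _*_; z≤n; s≤s)
open import Data.Nat.Properties using (m≤m+n; <⇒≱)
open import Data.Bool using (Bool; true; false; not; _∧_; if_then_else_)
import Data.Bool.Properties as Bool
open import Data.Fin using (join; Fin; zero; suc; fromℕ; #_; inject₁; splitAt; _↑ˡ_; _↑ʳ_)
import Data.Fin.Properties as Fin
open import Data.Fin.Induction using (<-weakInduction)
open import Data.List using (List; []; _∷_)
open import Data.List.Membership.Propositional using (_∈_)
open import Data.List.Relation.Unary.All as All using (All; []; _∷_; all?; lookup)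
open import Data.List.Relation.Unary.Any using (here; there)
open import Data.List.Relation.Unary.Linked using (Linked; [-]; _∷_; linked?)
open import Data.Maybe using (Maybe; just; nothing)
open import Data.Maybe.Properties using (just-injective)
import Data.Maybe.Properties as Maybeₚ
open import Data.Product using (Σ; ∃; _×_; _,_; proj₁; proj₂)
open import Data.Product.Properties using (≡-dec)
open import Data.Product.Algebra using (×-comm)
open import Data.Product.Function.NonDependent.Propositional using (_×-↔_)
open import Data.Sum using (_⊎_; inj₁; inj₂; [_,_]′)
open import Data.Sum.Properties using (inj₁-injective; inj₂-injective)
open import Function using (_∘_; _↔_; Inverse)
open import Function.Properties.Inverse using (↔-refl; ↔-sym; ↔-trans)
open import Relation.Binary.Definitions using (DecidableEquality)
open import Relation.Binary.PropositionalEquality using (_≡_; _≢_; refl; sym; trans; cong; cong₂; subst)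
open import Relation.Nullary.Decidable using (True; toWitness; _⊎-dec_; ¬?)
open import Relation.Nullary using (¬_; Dec; yes; no; contradiction)

-- Paths in the rotation around a single vertex.

module Walk {A : Set} (f : A × Bool → A × Bool) where

  switch : A × Bool → A × Bool
  switch (a , s) = a , not s

  data Path : A × Bool → A × Bool → Set where
    here : ∀ {x} → Path x x
    step : ∀ {x y} → Path (f x) y → Path x y
    flip : ∀ {x y} → Path (switch x) y → Path x y

  -- Asking for both sides at once lets a chain of edges be followed without recording on which side
  -- each step arrives; `flip` passes between the sides.
  Joins : A × Bool → A → Set
  Joins x a = ∀ s → Path (a , s) x

  flip-joins : ∀ {x a} s → Path (a , s) x → Joins x a
  flip-joins false p false = p
  flip-joins false p true  = flip p
  flip-joins true  p false = flip p
  flip-joins true  p true  = p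

  step-joins : ∀ {x a b} s → proj₁ (f (b , s)) ≡ a → Joins x a → Joins x b
  step-joins {b = b} s refl j = flip-joins s (step (j (proj₂ (f (b , s)))))

  path-trans : ∀ {x y z} → Path x y → Path y z → Path x z
  path-trans here     q = q
  path-trans (step p) q = step (path-trans p q)
  path-trans (flip p) q = flip (path-trans p q)

  module Reverse (Ok : A → Set)
                 (ok : ∀ x → Ok (proj₁ x) → Ok (proj₁ (f x)))
                 (inv : ∀ x → Ok (proj₁ x) → f (f x) ≡ x) where

    -- A `step` is undone by a second `step` only where `f` is an involution, that is over `Ok`, so
    -- this condition is carried along the path.
    path-sym : ∀ {x y} → Ok (proj₁ x) → Path x y → Path y x
    path-sym v here = here
    path-sym {x} {y} v (step p) =
      path-trans (path-sym (ok x v) p) (step (subst (λ z → Path z x) (sym (inv x v)) here))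
    path-sym {a , s} {y} v (flip p) =
      path-trans (path-sym v p)
        (flip (subst (λ t → Path (a , t) (a , s)) (sym (Bool.not-involutive s)) here))

  module Chain (_≟_ : DecidableEquality A) where

    -- Oriented backwards: in a list linked by `Hop`, each element steps, on some side, onto the
    -- element before it, so everything drains to the head.
    Hop : A → A → Set
    Hop a b = proj₁ (f (b , false)) ≡ a ⊎ proj₁ (f (b , true)) ≡ a

    hop? : ∀ a b → Dec (Hop a b)
    hop? a b = (proj₁ (f (b , false)) ≟ a) ⊎-dec (proj₁ (f (b , true)) ≟ a)

    chain-joins : ∀ {x a as} → Linked Hop (a ∷ as) → Joins x a → All (Joins x) (a ∷ as)
    chain-joins [-] j = j ∷ []
    chain-joins (inj₁ e ∷ l) j = j ∷ chain-joins l (step-joins false e j)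
    chain-joins (inj₂ e ∷ l) j = j ∷ chain-joins l (step-joins true e j)

open Walk using (Path; here; step; flip; Joins)

-- Embeddings as commuting row and column moves.

module _ {W J : Set} where

  rowMove : (W → J × Bool → J × Bool) → W × J × Bool → W × J × Bool
  rowMove C (w , j , s) = w , C w (j , s)

  columnMove : (J → W × Bool → W × Bool) → W × J × Bool → W × J × Bool
  columnMove R (w , j , s) = proj₁ (R j (w , s)) , j , proj₂ (R j (w , s))

-- A state (w , j , s) is a non-deleted edge wj together with one of the two
-- faces along it.  C moves to the other edge of that face at w, and R to the
-- other edge at j.
record Scheme (W J : Set) (Adj : W → J → Set) : Set where
  field
    C : W → J × Bool → J × Bool
    R : J → W × Bool → W × Bool

  moveC : W × J × Bool → W × J × Bool
  moveC = rowMove C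

  moveR : W × J × Bool → W × J × Bool
  moveR = columnMove R

  Valid : W × J × Bool → Set
  Valid x = Adj (proj₁ x) (proj₁ (proj₂ x))

  field
    C-valid : ∀ x → Valid x → Valid (moveC x)
    R-valid : ∀ x → Valid x → Valid (moveR x)
    C-involutive : ∀ x → Valid x → moveC (moveC x) ≡ x
    R-involutive : ∀ x → Valid x → moveR (moveR x) ≡ x
    commute : ∀ x → Valid x → moveC (moveR x) ≡ moveR (moveC x)
    C-moves : ∀ w j s → Adj w j → proj₁ (C w (j , s)) ≢ j
    R-moves : ∀ w j s → Adj w j → proj₁ (R j (w , s)) ≢ w
    C-joined : ∀ w → ∃ λ x → ∀ j → Adj w j → Joins (C w) x j
    R-joined : ∀ j → ∃ λ x → ∀ w → Adj w j → Joins (R j) x w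

  C-connected : ∀ w x y → Adj w (proj₁ x) → Adj w (proj₁ y) → Path (C w) x y
  C-connected w (j , s) (j′ , s′) a a′ =
    path-trans (proj₂ (C-joined w) j a s) (path-sym a′ (proj₂ (C-joined w) j′ a′ s′))
    where
    open Walk (C w)
    open Reverse (Adj w) (λ x → C-valid (w , x)) (λ x a → cong proj₂ (C-involutive (w , x) a))

  R-connected : ∀ j x y → Adj (proj₁ x) j → Adj (proj₁ y) j → Path (R j) x y
  R-connected j (w , s) (w′ , s′) a a′ =
    path-trans (proj₂ (R-joined j) w a s) (path-sym a′ (proj₂ (R-joined j) w′ a′ s′))
    where
    open Walk (R j)
    open Reverse (λ w → Adj w j) (λ x → R-valid (proj₁ x , j , proj₂ x))
                 (λ x a → cong (λ y → proj₁ y , proj₂ (proj₂ y)) (R-involutive (proj₁ x , j , proj₂ x) a))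

-- From a scheme to a quadrangular embedding, with a test for nonorientability.

module Realise {N : ℕ} {J : Set} (black : J ↔ Fin N)
               (S : Scheme (Maybe J) J (λ w j → w ≢ just j)) where

  open Scheme S

  W = Maybe J

  private
    enJ = Inverse.to black
    deJ = Inverse.from black

  deJ-enJ : ∀ j → deJ (enJ j) ≡ j
  deJ-enJ = Inverse.strictlyInverseʳ black

  enJ-deJ : ∀ j → enJ (deJ j) ≡ j
  enJ-deJ = Inverse.strictlyInverseˡ black

  -- Row `just j` gets the number of column `j`, so the deleted cells become the diagonal. The extra
  -- row gets the number `N`, which the bound in `IsEdge N` keeps out of the matching.
  enW : W → Fin (N + 1)
  enW (just j) = enJ j ↑ˡ 1
  enW nothing  = N ↑ʳ zero

  split-white : Fin N ⊎ Fin 1 → W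
  split-white = [ just ∘ deJ , (λ _ → nothing) ]′

  deW : Fin (N + 1) → W
  deW i = split-white (splitAt N i)

  deW-enW : ∀ w → deW (enW w) ≡ w
  deW-enW (just j) = trans (cong split-white (Fin.splitAt-↑ˡ N (enJ j) 1)) (cong just (deJ-enJ j))
  deW-enW nothing  = cong split-white (Fin.splitAt-↑ʳ N 1 zero)

  enW-split : ∀ x → enW (split-white x) ≡ join N 1 x
  enW-split (inj₁ i) = cong (_↑ˡ 1) (enJ-deJ i)
  enW-split (inj₂ zero) = refl

  enW-deW : ∀ i → enW (deW i) ≡ i
  enW-deW i = trans (enW-split (splitAt N i)) (Fin.join-splitAt N 1 i)

  en : (W × J × Bool) × Bool → Flag (N + 1) N
  en ((w , j , s) , e) = enW w , enJ j , e , s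

  de : Flag (N + 1) N → (W × J × Bool) × Bool
  de (i , j , e , s) = (deW i , deJ j , s) , e

  de-en : ∀ x → de (en x) ≡ x
  de-en ((w , j , s) , e) = cong₂ (λ w j → (w , j , s) , e) (deW-enW w) (deJ-enJ j)

  en-de : ∀ f → en (de f) ≡ f
  en-de (i , j , e , s) = cong₂ (λ i j → i , j , e , s) (enW-deW i) (enJ-deJ j)

  adj⇒edge : ∀ w j → w ≢ just j → IsEdge N (enW w) (enJ j)
  adj⇒edge (just i) j w≢j (eq , _) = w≢j (cong just
    (trans (sym (deJ-enJ i)) (trans (cong deJ (Fin.toℕ-injective
      (trans (sym (Fin.toℕ-↑ˡ (enJ i) 1)) eq))) (deJ-enJ j))))
  adj⇒edge nothing j _ (_ , lt) =
    <⇒≱ lt (subst (N ≤_) (sym (Fin.toℕ-↑ʳ N (zero {n = 0}))) (m≤m+n N 0))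

  edge⇒adj : ∀ w j → IsEdge N (enW w) (enJ j) → w ≢ just j
  edge⇒adj w j edge refl = edge (Fin.toℕ-↑ˡ (enJ j) 1
    , subst (_< N) (sym (Fin.toℕ-↑ˡ (enJ j) 1)) (Fin.toℕ<n (enJ j)))

  valid⇒ : ∀ x e → Valid x → ValidFlag N (en (x , e))
  valid⇒ (w , j , _) _ = adj⇒edge w j

  ⇒valid : ∀ x e → ValidFlag N (en (x , e)) → Valid x
  ⇒valid (w , j , _) _ = edge⇒adj w j

  turn : (W × J × Bool) × Bool → (W × J × Bool) × Bool
  turn (x , false) = moveC x , false
  turn (x , true)  = moveR x , true

  τ : Flag (N + 1) N → Flag (N + 1) N
  τ f = en (turn (de f))

  τ-en : ∀ x → τ (en x) ≡ en (turn x)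
  τ-en x = cong (en ∘ turn) (de-en x)

  -- Reduces claims about flags to states, where moves act on `J` and `Maybe J` and no `Fin`
  -- arithmetic appears.
  every-flag : (P : Flag (N + 1) N → Set) →
               (∀ x e → Valid x → P (en (x , e))) → ∀ f → ValidFlag N f → P f
  every-flag P h f v = subst P (en-de f)
    (h (proj₁ (de f)) (proj₂ (de f)) (⇒valid (proj₁ (de f)) (proj₂ (de f))
      (subst (ValidFlag N) (sym (en-de f)) v)))

  τ-valid : ∀ x e → Valid x → ValidFlag N (τ (en (x , e)))
  τ-valid x false v = subst (ValidFlag N) (sym (τ-en (x , false))) (valid⇒ (moveC x) false (C-valid x v))
  τ-valid x true  v = subst (ValidFlag N) (sym (τ-en (x , true)))  (valid⇒ (moveR x) true  (R-valid x v))

  turn-involutive : ∀ x e → Valid x → turn (turn (x , e)) ≡ (x , e)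
  turn-involutive x false v = cong (_, false) (C-involutive x v)
  turn-involutive x true  v = cong (_, true)  (R-involutive x v)

  τ-involutive : ∀ x e → Valid x → τ (τ (en (x , e))) ≡ en (x , e)
  τ-involutive x e v = trans (cong τ (τ-en (x , e)))
    (trans (τ-en (turn (x , e))) (cong en (turn-involutive x e v)))

  turn-vertex : ∀ x e → flagVertex (en (turn (x , e))) ≡ flagVertex (en (x , e))
  turn-vertex x false = refl
  turn-vertex x true  = refl

  enJ-injective : ∀ {i j} → enJ i ≡ enJ j → i ≡ j
  enJ-injective {i} {j} eq = trans (sym (deJ-enJ i)) (trans (cong deJ eq) (deJ-enJ j))

  enW-injective : ∀ {i j} → enW i ≡ enW j → i ≡ j
  enW-injective {i} {j} eq = trans (sym (deW-enW i)) (trans (cong deW eq) (deW-enW j))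

  turn-edge : ∀ x e → Valid x → flagEdge (en (turn (x , e))) ≢ flagEdge (en (x , e))
  turn-edge (w , j , s) false v eq = C-moves w j s v (enJ-injective (cong proj₂ eq))
  turn-edge (w , j , s) true  v eq = R-moves w j s v (enW-injective (cong proj₁ eq))

  walk-C : ∀ w {x y} → Path (C w) x y → Reach τ (en ((w , x) , false)) (en ((w , y) , false))
  walk-C w here = here
  walk-C w {x} {y} (step p) = viaρ (subst (λ f → Reach τ f (en ((w , y) , false)))
    (sym (τ-en ((w , x) , false))) (walk-C w p))
  walk-C w (flip p) = viaτ₂ (walk-C w p)

  walk-R : ∀ j {w s w′ s′} → Path (R j) (w , s) (w′ , s′) →
           Reach τ (en ((w , j , s) , true)) (en ((w′ , j , s′) , true))
  walk-R j here = here
  walk-R j {w} {s} {w′} {s′} (step p) =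
    viaρ (subst (λ f → Reach τ f (en ((w′ , j , s′) , true)))
      (sym (τ-en ((w , j , s) , true))) (walk-R j p))
  walk-R j (flip p) = viaτ₂ (walk-R j p)

  orbit : ∀ x e → Valid x → ∀ y d → Valid y →
          flagVertex (en (x , e)) ≡ flagVertex (en (y , d)) → Reach τ (en (x , e)) (en (y , d))
  orbit (w , x) false v (w′ , y) false v′ eq
    with refl ← enW-injective {w} {w′} (inj₁-injective eq) = walk-C w (C-connected w x y v v′)
  orbit (w , j , s) true v (w′ , j′ , s′) true v′ eq
    with refl ← enJ-injective {j} {j′} (inj₂-injective eq) =
    walk-R j (R-connected j (w , s) (w′ , s′) v v′)

  embedding : Embedding (N + 1) N N
  embedding = record
    { τ₁ = τ
    ; valid = every-flag (λ f → ValidFlag N (τ f)) τ-valid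
    ; involutive = every-flag (λ f → τ (τ f) ≡ f) τ-involutive
    ; sameVertex = every-flag (λ f → flagVertex (τ f) ≡ flagVertex f)
        (λ x e _ → trans (cong flagVertex (τ-en (x , e))) (turn-vertex x e))
    ; otherEdge = every-flag (λ f → flagEdge (τ f) ≢ flagEdge f)
        (λ x e v → subst (λ f → flagEdge f ≢ flagEdge (en (x , e)))
          (sym (τ-en (x , e))) (turn-edge x e v))
    ; vertexOrbit = λ f g v → every-flag (λ g → flagVertex f ≡ flagVertex g → Reach τ f g)
        (λ y d v′ → every-flag (λ f → flagVertex f ≡ flagVertex (en (y , d)) →
              Reach τ f (en (y , d)))
          (λ x e v → orbit x e v y d v′) f v) g
    }

  -- The face step read on states: `τ₀` first toggles the end, then `turn` applies the move
  -- belonging to the new end.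
  stride : (W × J × Bool) × Bool → (W × J × Bool) × Bool
  stride (x , e) = turn (x , not e)

  iter-en : ∀ r x → iter r (faceStep embedding) (en x) ≡ en (iter r stride x)
  iter-en zero x = refl
  iter-en (suc r) x with iter r (faceStep embedding) (en x) | iter-en r x
  ... | _ | refl = τ-en (proj₁ y , not (proj₂ y))
    where y = iter r stride x

  -- Two commuting involutions have a product of order dividing two; four strides perform exactly
  -- this product twice.
  CRCR : ∀ x → Valid x → moveC (moveR (moveC (moveR x))) ≡ x
  CRCR x v = trans (cong moveC (trans (sym (commute (moveR x) (R-valid x v)))
    (cong moveC (R-involutive x v)))) (C-involutive x v)

  RCRC : ∀ x → Valid x → moveR (moveC (moveR (moveC x))) ≡ x
  RCRC x v = trans (cong moveR (trans (commute (moveC x) (C-valid x v))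
    (cong moveR (C-involutive x v)))) (R-involutive x v)

  four : ∀ x e → Valid x → iter 4 stride (x , e) ≡ (x , e)
  four x false v = cong (_, false) (CRCR x v)
  four x true  v = cong (_, true) (RCRC x v)

  -- An odd number of strides ends at the other endpoint of an edge. Two strides apply each move
  -- once, and the move made first changes the row or the column in a way that the second cannot
  -- undo.
  fewer : ∀ x e → Valid x → ∀ r → 1 ≤ r → r < 4 → iter r stride (x , e) ≢ (x , e)
  fewer x false v 1 _ _ ()
  fewer x true  v 1 _ _ ()
  fewer (w , j , s) false v 2 _ _ eq = R-moves w j s v (cong (λ { ((w , _) , _) → w }) eq)
  fewer (w , j , s) true  v 2 _ _ eq = C-moves w j s v (cong (λ { ((_ , j , _) , _) → j }) eq)
  fewer x false v 3 _ _ ()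
  fewer x true  v 3 _ _ ()
  fewer x e v (suc (suc (suc (suc _)))) _ (s≤s (s≤s (s≤s (s≤s ()))))

  quadrangular : Quadrangular embedding
  quadrangular = every-flag _ λ x e v →
      trans (iter-en 4 (x , e)) (cong en (four x e v))
    , λ r lo hi eq → fewer x e v r lo hi (trans (sym (de-en _))
        (trans (cong de (trans (sym (iter-en r (x , e))) eq)) (de-en _)))

  switch : W × J × Bool → W × J × Bool
  switch (w , j , s) = w , j , not s

  data Move : Set where
    c r f : Move

  move : Move → W × J × Bool → W × J × Bool
  move c = moveC
  move r = moveR
  move f = switch

  move-valid : ∀ m x → Valid x → Valid (move m x)
  move-valid c x v = C-valid x v
  move-valid r x v = R-valid x v
  move-valid f x v = v

  run : List Move → W × J × Bool → W × J × Bool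
  run []       x = x
  run (m ∷ ms) x = run ms (move m x)

  parity : List Move → Bool → Bool
  parity []       b = b
  parity (_ ∷ ms) b = parity ms (not b)

  module Coloured (o : Orientable embedding) where

    colour : W × J × Bool → Bool
    colour x = proj₁ o (en (x , false))

    differ : ∀ x e → Valid x → _
    differ x e v = proj₂ o (en (x , e)) (valid⇒ x e v)

    colour-black : ∀ x → Valid x → proj₁ o (en (x , true)) ≡ not (colour x)
    colour-black x v = Bool.¬-not (proj₁ (differ x false v))

    turn-not : ∀ x e → Valid x → proj₁ o (en (turn (x , e))) ≡ not (proj₁ o (en (x , e)))
    turn-not x e v = Bool.¬-not (subst (λ g → proj₁ o g ≢ proj₁ o (en (x , e))) (τ-en (x , e))
      (proj₁ (proj₂ (differ x e v))))

    -- `colour` looks at white ends only, so `moveR` must be conjugated by `τ₀`: it costs three flag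
    -- moves, still an odd number.
    colour-move : ∀ m x → Valid x → colour (move m x) ≡ not (colour x)
    colour-move c x v = turn-not x false v
    colour-move f x v = Bool.¬-not (proj₂ (proj₂ (differ x false v)))
    colour-move r x v = Bool.not-injective
      (trans (sym (colour-black (moveR x) (R-valid x v)))
        (trans (turn-not x true v) (cong not (colour-black x v))))

    colour-run : ∀ ms x → Valid x → colour (run ms x) ≡ parity ms (colour x)
    colour-run []       x v = refl
    colour-run (m ∷ ms) x v =
      trans (colour-run ms (move m x) (move-valid m x v)) (cong (parity ms) (colour-move m x v))

  nonorientable : ∀ ms x → Valid x → run ms x ≡ x → (∀ b → parity ms b ≡ not b) →
                  Nonorientable embedding
  nonorientable ms x v closed odd o = Bool.not-¬ refl
    (sym (trans (sym (odd (colour x))) (trans (sym (colour-run ms x v)) (cong colour closed))))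
    where open Coloured o


-- The checkerboard scheme before the replacement.

-- π false and π true are two perfect matchings of J whose union is a cycle
-- through J.  At the white vertex i the rotation follows this cycle, skipping i;
-- at the black vertex j it follows the same cycle with j replaced by nothing.
-- Side s of the edge ij lies in the face {i, π s i} × {j, π s j}, unless π s j = i,
-- when the face is {nothing, i} × {π false i, π true i}.
module Checkerboard {J : Set} (_≟_ : DecidableEquality J) (π : Bool → J → J)
                    (π-involutive : ∀ s j → π s (π s j) ≡ j)
                    (π-moves : ∀ s j → π s j ≢ j)
                    (π-apart : ∀ s j → π s j ≢ π (not s) j) where

  C₀ : Maybe J → J × Bool → J × Bool
  -- The face here is that of row `i = π s j`. Its second column `π (not s) i` meets `i` through the
  -- other matching, hence the change of side. Both columns are neighbours of `i` on the cycle, so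
  -- parity is preserved.
  C₀ nothing (j , s) = π (not s) (π s j) , not s
  C₀ (just i) (j , s) with π s j ≟ i
  ... | yes _ = π (not s) i , not s
  ... | no _  = π s j , s

  R₀ : J → Maybe J × Bool → Maybe J × Bool
  R₀ j (nothing , s) = just (π s j) , s
  R₀ j (just i , s) with π s i ≟ j
  ... | yes _ = nothing , s
  ... | no _  = just (π s i) , s

  C₀-skip : ∀ i j s → π s j ≡ i → C₀ (just i) (j , s) ≡ (π (not s) i , not s)
  C₀-skip i j s eq with π s j ≟ i
  ... | yes _ = refl
  ... | no ne = contradiction eq ne

  C₀-step : ∀ i j s → π s j ≢ i → C₀ (just i) (j , s) ≡ (π s j , s)
  C₀-step i j s ne with π s j ≟ i
  ... | yes eq = contradiction eq ne
  ... | no _   = refl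

  R₀-skip : ∀ i j s → π s i ≡ j → R₀ j (just i , s) ≡ (nothing , s)
  R₀-skip i j s eq with π s i ≟ j
  ... | yes _ = refl
  ... | no ne = contradiction eq ne

  R₀-step : ∀ i j s → π s i ≢ j → R₀ j (just i , s) ≡ (just (π s i) , s)
  R₀-step i j s ne with π s i ≟ j
  ... | yes eq = contradiction eq ne
  ... | no _   = refl

  π-adjoint : ∀ s {i j} → π s i ≡ j → π s j ≡ i
  π-adjoint s refl = π-involutive s _

  π-injective : ∀ s {i j} → π s i ≡ π s j → i ≡ j
  π-injective s {i} {j} eq =
    trans (sym (π-involutive s i)) (trans (cong (π s) eq) (π-involutive s j))

  Valid : Maybe J × J × Bool → Set
  Valid (w , j , _) = w ≢ just j

  moveC₀ moveR₀ : Maybe J × J × Bool → Maybe J × J × Bool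
  moveC₀ = rowMove C₀
  moveR₀ = columnMove R₀

  moveC₀-skip : ∀ i j s → π s j ≡ i → moveC₀ (just i , j , s) ≡ (just i , π (not s) i , not s)
  moveC₀-skip i j s eq = cong (just i ,_) (C₀-skip i j s eq)

  moveC₀-step : ∀ i j s → π s j ≢ i → moveC₀ (just i , j , s) ≡ (just i , π s j , s)
  moveC₀-step i j s ne = cong (just i ,_) (C₀-step i j s ne)

  moveR₀-skip : ∀ i j s → π s i ≡ j → moveR₀ (just i , j , s) ≡ (nothing , j , s)
  moveR₀-skip i j s eq = cong (λ { (w , s) → w , j , s }) (R₀-skip i j s eq)

  moveR₀-step : ∀ i j s → π s i ≢ j → moveR₀ (just i , j , s) ≡ (just (π s i) , j , s)
  moveR₀-step i j s ne = cong (λ { (w , s) → w , j , s }) (R₀-step i j s ne)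

  C₀-valid : ∀ x → Valid x → Valid (moveC₀ x)
  C₀-valid (nothing , _) _ ()
  C₀-valid (just i , j , s) v with π s j ≟ i
  ... | yes _ = λ eq → π-moves (not s) i (sym (just-injective eq))
  ... | no ne = λ eq → ne (sym (just-injective eq))

  R₀-valid : ∀ x → Valid x → Valid (moveR₀ x)
  R₀-valid (nothing , j , s) _ eq = π-moves s j (just-injective eq)
  R₀-valid (just i , j , s) v with π s i ≟ j
  ... | yes _ = λ ()
  ... | no ne = λ eq → ne (just-injective eq)

  C₀-involutive : ∀ x → Valid x → moveC₀ (moveC₀ x) ≡ x
  C₀-involutive (nothing , j , s)
    rewrite π-involutive (not s) (π s j) | Bool.not-involutive s | π-involutive s j = λ _ → refl
  C₀-involutive (just i , j , s) v with π s j ≟ i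
  ... | yes refl = trans (moveC₀-skip i (π (not s) i) (not s) (π-involutive (not s) i))
                         (cong₂ (λ t k → just i , k , t) (Bool.not-involutive s)
                           (trans (cong (λ t → π t i) (Bool.not-involutive s)) (π-involutive s j)))
  ... | no _ = trans (moveC₀-step i (π s j) s λ eq → v (cong just (trans (sym eq) (π-involutive s j))))
                     (cong (λ k → just i , k , s) (π-involutive s j))

  R₀-involutive : ∀ x → Valid x → moveR₀ (moveR₀ x) ≡ x
  R₀-involutive (nothing , j , s) _ = moveR₀-skip (π s j) j s (π-involutive s j)
  R₀-involutive (just i , j , s) v with π s i ≟ j
  ... | yes eq = cong (λ k → just k , j , s) (π-adjoint s eq)
  ... | no _ = trans (moveR₀-step (π s i) j s λ eq → v (cong just (trans (sym (π-involutive s i)) eq)))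
                     (cong (λ k → just k , j , s) (π-involutive s i))

  -- By `π-adjoint` the tests `π s j ≟ i` and `π s i ≟ j` agree, so both moves see the same face:
  -- one through row `nothing`, or a square. In a square, injectivity of `π s` keeps the opposite
  -- corner off the diagonal, so the second move takes its ordinary branch.
  commute₀ : ∀ x → Valid x → moveC₀ (moveR₀ x) ≡ moveR₀ (moveC₀ x)
  commute₀ (nothing , j , s) _ = trans (moveC₀-skip (π s j) j s refl)
    (cong (λ k → just k , π (not s) (π s j) , not s) (sym (π-involutive (not s) (π s j))))
  commute₀ (just i , j , s) v with π s j ≟ i
  ... | yes refl = trans (cong moveC₀ (moveR₀-skip i j s (π-involutive s j)))
                         (sym (moveR₀-skip i (π (not s) i) (not s) refl))
  ... | no ne = trans (cong moveC₀ (moveR₀-step i j s (ne ∘ π-adjoint s)))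
                (trans (moveC₀-step (π s i) j s (i≢j ∘ sym))
                       (sym (moveR₀-step i (π s j) s i≢j)))
    where
    i≢j : π s i ≢ π s j
    i≢j eq = v (cong just (π-injective s eq))

  C₀-moves : ∀ w j s → Valid (w , j , s) → proj₁ (C₀ w (j , s)) ≢ j
  C₀-moves nothing j s _ eq = π-apart s j (sym (π-adjoint (not s) eq))
  C₀-moves (just i) j s v with π s j ≟ i
  ... | yes refl = λ eq → π-apart s j (sym (π-adjoint (not s) eq))
  ... | no _ = π-moves s j

  R₀-moves : ∀ w j s → Valid (w , j , s) → proj₁ (R₀ j (w , s)) ≢ w
  R₀-moves nothing j s _ ()
  R₀-moves (just i) j s v with π s i ≟ j
  ... | yes _ = λ ()
  ... | no _ = λ eq → π-moves s i (just-injective eq)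

-- Replacing an involution on an invariant set.

module Patched {X K : Set} (Valid : X → Set) (at : K → X) (f₀ f : X → X) (f′ : K → K)
  (inside : ∀ k → f (at k) ≡ at (f′ k))
  (outside : ∀ x → ¬ (∃ λ k → at k ≡ x) → f x ≡ f₀ x)
  (closed : ∀ k → ∃ λ l → at l ≡ f₀ (at k))
  (slot? : ∀ x → Dec (∃ λ k → at k ≡ x))
  (at-valid : ∀ k → Valid (at k))
  (f′-involutive : ∀ k → f′ (f′ k) ≡ k)
  (f₀-valid : ∀ x → Valid x → Valid (f₀ x))
  (f₀-involutive : ∀ x → Valid x → f₀ (f₀ x) ≡ x)
  where

  Slot : X → Set
  Slot x = ∃ λ k → at k ≡ x

  -- If `f₀ x` were a slot, applying `f₀` again would stay among the slots by `closed` and return to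
  -- `x`.
  off : ∀ x → Valid x → ¬ Slot x → ¬ Slot (f₀ x)
  off x v ¬s (k , eq) = ¬s (subst Slot (trans (cong f₀ eq) (f₀-involutive x v)) (closed k))

  f-valid : ∀ x → Valid x → Valid (f x)
  f-valid x v with slot? x
  ... | yes (k , refl) = subst Valid (sym (inside k)) (at-valid (f′ k))
  ... | no ¬s = subst Valid (sym (outside x ¬s)) (f₀-valid x v)

  f-involutive : ∀ x → Valid x → f (f x) ≡ x
  f-involutive x v with slot? x
  ... | yes (k , refl) = trans (cong f (inside k)) (trans (inside (f′ k)) (cong at (f′-involutive k)))
  ... | no ¬s = trans (cong f (outside x ¬s))
                      (trans (outside (f₀ x) (off x v ¬s)) (f₀-involutive x v))

-- Cyclic successor and predecessor.

next : ∀ {n} → Fin (suc n) → Fin (suc n)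
next {zero}  zero    = zero
next {suc n} zero    = suc zero
next {suc n} (suc i) with next i
... | zero  = zero
... | suc k = suc (suc k)

prev : ∀ {n} → Fin (suc n) → Fin (suc n)
prev {n} zero = fromℕ n
prev (suc i)  = inject₁ i

next-inject₁ : ∀ {n} (i : Fin n) → next (inject₁ i) ≡ suc i
next-inject₁ zero = refl
next-inject₁ (suc i) rewrite next-inject₁ i = refl

next-fromℕ : ∀ n → next (fromℕ n) ≡ zero
next-fromℕ zero = refl
next-fromℕ (suc n) rewrite next-fromℕ n = refl

next-prev : ∀ {n} (i : Fin (suc n)) → next (prev i) ≡ i
next-prev zero    = next-fromℕ _
next-prev (suc i) = next-inject₁ i

prev-next : ∀ {n} (i : Fin (suc n)) → prev (next i) ≡ i
prev-next {zero}  zero = refl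
prev-next {suc n} zero = refl
prev-next {suc n} (suc i) with next i | prev-next i
... | zero  | eq = cong suc eq
... | suc k | eq = cong suc eq

next-moves : ∀ {n} (i : Fin (2 + n)) → next i ≢ i
next-moves zero ()
next-moves {zero}  (suc zero) ()
next-moves {suc n} (suc i) with next i | next-moves i
... | zero  | _  = λ ()
... | suc k | ne = ne ∘ Fin.suc-injective

prev-moves : ∀ {n} (i : Fin (2 + n)) → prev i ≢ i
prev-moves i eq = next-moves i (trans (cong next (sym eq)) (next-prev i))

all-bool? : {P : Bool → Set} → (∀ b → Dec (P b)) → Dec (∀ b → P b)
all-bool? P? with P? false | P? true
... | yes p | yes q = yes λ { false → p ; true → q }
... | no ¬p | _     = no λ h → ¬p (h false)
... | yes _ | no ¬q = no λ h → ¬q (h true)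

-- Replacing the five rectangles, for n = 3 + m.

module Construction (m : ℕ) where

  J : Set
  J = Fin (3 + m) × Bool

  W : Set
  W = Maybe J

  X : Set
  X = W × J × Bool

  _≟J_ : DecidableEquality J
  _≟J_ = ≡-dec Fin._≟_ Bool._≟_

  _≟W_ : DecidableEquality W
  _≟W_ = Maybeₚ.≡-dec _≟J_

  _≟X_ : DecidableEquality X
  _≟X_ = ≡-dec _≟W_ (≡-dec _≟J_ Bool._≟_)

  -- The two alternate edge classes of the 2n-cycle: with `(i , b)` read as 2i + b, `π false` pairs
  -- 2i with 2i + 1, and `π true` pairs 2i + 1 with 2i + 2 modulo 2n.
  π : Bool → J → J
  π false (i , b)     = i , not b
  π true  (i , false) = prev i , true
  π true  (i , true)  = next i , false

  π-involutive : ∀ s j → π s (π s j) ≡ j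
  π-involutive false (i , b)     = cong (i ,_) (Bool.not-involutive b)
  π-involutive true  (i , false) = cong (_, false) (next-prev i)
  π-involutive true  (i , true)  = cong (_, true) (prev-next i)

  π-moves : ∀ s j → π s j ≢ j
  π-moves false (i , false) ()
  π-moves false (i , true) ()
  π-moves true  (i , false) ()
  π-moves true  (i , true) ()

  π-apart : ∀ s j → π s j ≢ π (not s) j
  π-apart false (i , false) eq = prev-moves i (sym (cong proj₁ eq))
  π-apart false (i , true)  eq = next-moves i (sym (cong proj₁ eq))
  π-apart true  (i , false) eq = prev-moves i (cong proj₁ eq)
  π-apart true  (i , true)  eq = next-moves i (cong proj₁ eq)

  open Checkerboard _≟J_ π π-involutive π-moves π-apart

  pattern j₀ = zero , false
  pattern j₁ = zero , true
  pattern j₂ = suc zero , false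
  pattern j₃ = suc zero , true
  pattern j₄ = suc (suc zero) , false
  pattern j₅ = suc (suc zero) , true

  -- The five new rectangles; (i , b) stands for the number 2i + b and nothing for ∞.
  -- side says which of the two old faces at the corner is the one replaced.
  row : Fin 5 → Bool → W
  row zero                         p = if p then just j₄ else just j₂
  row (suc zero)                   p = if p then just j₅ else just j₂
  row (suc (suc zero))             p = if p then nothing else just j₃
  row (suc (suc (suc zero)))       p = if p then just j₁ else just j₄
  row (suc (suc (suc (suc zero)))) p = if p then nothing else just j₅

  column : Fin 5 → Bool → J
  column zero                         q = if q then j₁ else j₃
  column (suc zero)                   q = if q then j₁ else j₀
  column (suc (suc zero))             q = if q then j₁ else j₀
  column (suc (suc (suc zero)))       q = if q then j₀ else j₂
  column (suc (suc (suc (suc zero)))) q = if q then j₃ else j₂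

  side : Fin 5 → Bool → Bool → Bool
  side zero                         p q = false
  side (suc zero)                   p q = not p ∧ q
  side (suc (suc zero))             p q = p ∧ q
  side (suc (suc (suc zero)))       p q = p ∧ not q
  side (suc (suc (suc (suc zero)))) p q = p ∧ not q

  Corner : Set
  Corner = Fin 5 × Bool × Bool

  at : Corner → X
  at (r , p , q) = row r p , column r q , side r p q

  Slot : X → Set
  Slot x = ∃ λ k → at k ≡ x

  -- Inverse table of `at`. The column is matched first, so that from column 4 on the table reduces
  -- to `nothing` even for an unknown row, and the patched moves unfold to the old ones.
  corner? : J → W → Bool → Maybe Corner
  corner? (j₀) (just (j₁)) false = just (# 3 , true , true)
  corner? (j₀) (just (j₂)) false = just (# 1 , false , false)
  corner? (j₀) (just (j₃)) false = just (# 2 , false , false)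
  corner? (j₀) (just (j₄)) false = just (# 3 , false , true)
  corner? (j₀) (just (j₅)) false = just (# 1 , true , false)
  corner? (j₀) nothing false = just (# 2 , true , false)
  corner? (j₁) (just (j₂)) false = just (# 0 , false , true)
  corner? (j₁) (just (j₂)) true  = just (# 1 , false , true)
  corner? (j₁) (just (j₃)) false = just (# 2 , false , true)
  corner? (j₁) (just (j₄)) false = just (# 0 , true , true)
  corner? (j₁) (just (j₅)) false = just (# 1 , true , true)
  corner? (j₁) nothing true  = just (# 2 , true , true)
  corner? (j₂) (just (j₁)) true  = just (# 3 , true , false)
  corner? (j₂) (just (j₄)) false = just (# 3 , false , false)
  corner? (j₂) (just (j₅)) false = just (# 4 , false , false)
  corner? (j₂) nothing true  = just (# 4 , true , false)
  corner? (j₃) (just (j₂)) false = just (# 0 , false , false)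
  corner? (j₃) (just (j₄)) false = just (# 0 , true , false)
  corner? (j₃) (just (j₅)) false = just (# 4 , false , true)
  corner? (j₃) nothing false = just (# 4 , true , true)
  corner? _ _ _ = nothing

  corner?-at : ∀ r p q → corner? (column r q) (row r p) (side r p q) ≡ just (r , p , q)
  corner?-at zero false false = refl
  corner?-at zero false true = refl
  corner?-at zero true false = refl
  corner?-at zero true true = refl
  corner?-at (suc zero) false false = refl
  corner?-at (suc zero) false true = refl
  corner?-at (suc zero) true false = refl
  corner?-at (suc zero) true true = refl
  corner?-at (suc (suc zero)) false false = refl
  corner?-at (suc (suc zero)) false true = refl
  corner?-at (suc (suc zero)) true false = refl
  corner?-at (suc (suc zero)) true true = refl
  corner?-at (suc (suc (suc zero))) false false = refl
  corner?-at (suc (suc (suc zero))) false true = refl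
  corner?-at (suc (suc (suc zero))) true false = refl
  corner?-at (suc (suc (suc zero))) true true = refl
  corner?-at (suc (suc (suc (suc zero)))) false false = refl
  corner?-at (suc (suc (suc (suc zero)))) false true = refl
  corner?-at (suc (suc (suc (suc zero)))) true false = refl
  corner?-at (suc (suc (suc (suc zero)))) true true = refl

  slot? : ∀ x → Dec (Slot x)
  slot? (w , j , s) with corner? j w s in found
  ... | nothing = no λ { ((r , p , q) , refl) → contradiction (trans (sym found) (corner?-at r p q)) λ () }
  ... | just k with at k ≟X (w , j , s)
  ...   | yes eq = yes (k , eq)
  ...   | no ne  = no λ { (l@(r , p , q) , refl) →
                          ne (cong at (just-injective (trans (sym found) (corner?-at r p q)))) }

  -- The twenty corners are checked by evaluation while `m` stays a variable.
  corners : {P : Corner → Set} (P? : ∀ k → Dec (P k)) →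
            {True (Fin.all? λ r → all-bool? λ p → all-bool? λ q → P? (r , p , q))} → ∀ k → P k
  corners P? {t} (r , p , q) = toWitness t r p q

  C : W → J × Bool → J × Bool
  C w (j , s) with slot? (w , j , s)
  ... | yes ((r , p , q) , _) = column r (not q) , side r p (not q)
  ... | no _ = C₀ w (j , s)

  R : J → W × Bool → W × Bool
  R j (w , s) with slot? (w , j , s)
  ... | yes ((r , p , q) , _) = row r (not p) , side r (not p) q
  ... | no _ = R₀ j (w , s)

  C-corner R-corner : Corner → Corner
  C-corner (r , p , q) = r , p , not q
  R-corner (r , p , q) = r , not p , q

  C-inside : ∀ k → rowMove C (at k) ≡ at (C-corner k)
  C-inside = corners λ k → rowMove C (at k) ≟X at (C-corner k)

  R-inside : ∀ k → columnMove R (at k) ≡ at (R-corner k)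
  R-inside = corners λ k → columnMove R (at k) ≟X at (R-corner k)

  C-outside : ∀ x → ¬ Slot x → rowMove C x ≡ moveC₀ x
  C-outside (w , j , s) ¬s with slot? (w , j , s)
  ... | yes t = contradiction t ¬s
  ... | no _  = refl

  R-outside : ∀ x → ¬ Slot x → columnMove R x ≡ moveR₀ x
  R-outside (w , j , s) ¬s with slot? (w , j , s)
  ... | yes t = contradiction t ¬s
  ... | no _  = refl

  -- The five old rectangles occupy exactly the same twenty cell sides as the five new ones, so the
  -- old moves permute the slots.
  C-closed : ∀ k → Slot (moveC₀ (at k))
  C-closed = corners λ k → slot? (moveC₀ (at k))

  R-closed : ∀ k → Slot (moveR₀ (at k))
  R-closed = corners λ k → slot? (moveR₀ (at k))

  at-valid : ∀ k → Valid (at k)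
  at-valid = corners λ { (r , p , q) → ¬? (row r p ≟W just (column r q)) }

  C-corner-involutive : ∀ k → C-corner (C-corner k) ≡ k
  C-corner-involutive (r , p , q) = cong (λ q → r , p , q) (Bool.not-involutive q)

  R-corner-involutive : ∀ k → R-corner (R-corner k) ≡ k
  R-corner-involutive (r , p , q) = cong (λ p → r , p , q) (Bool.not-involutive p)

  module PC = Patched Valid at moveC₀ (rowMove C) C-corner C-inside C-outside C-closed slot?
    at-valid C-corner-involutive C₀-valid C₀-involutive

  module PR = Patched Valid at moveR₀ (columnMove R) R-corner R-inside R-outside R-closed slot?
    at-valid R-corner-involutive R₀-valid R₀-involutive

  -- At a slot the moves toggle the independent coordinates `q` and `p`. Elsewhere neither old move
  -- enters a slot, so `commute₀` applies unchanged.
  commute : ∀ x → Valid x → rowMove C (columnMove R x) ≡ columnMove R (rowMove C x)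
  commute x v = by (slot? x)
    where
    by : Dec (Slot x) → rowMove C (columnMove R x) ≡ columnMove R (rowMove C x)
    by (yes (k , refl)) = trans (trans (cong (rowMove C) (R-inside k)) (C-inside (R-corner k)))
      (sym (trans (cong (columnMove R) (C-inside k)) (R-inside (C-corner k))))
    by (no ¬s) = trans (trans (cong (rowMove C) (R-outside x ¬s)) (C-outside (moveR₀ x) (PR.off x v ¬s)))
      (trans (commute₀ x v)
        (sym (trans (cong (columnMove R) (C-outside x ¬s)) (R-outside (moveC₀ x) (PC.off x v ¬s)))))

  columns-differ : ∀ k → proj₁ (proj₂ (at (C-corner k))) ≢ proj₁ (proj₂ (at k))
  columns-differ = corners λ k → ¬? (proj₁ (proj₂ (at (C-corner k))) ≟J proj₁ (proj₂ (at k)))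

  rows-differ : ∀ k → proj₁ (at (R-corner k)) ≢ proj₁ (at k)
  rows-differ = corners λ k → ¬? (proj₁ (at (R-corner k)) ≟W proj₁ (at k))

  C-moves : ∀ w j s → Valid (w , j , s) → proj₁ (C w (j , s)) ≢ j
  C-moves w j s v with slot? (w , j , s)
  ... | yes (k , refl) = columns-differ k
  ... | no _ = C₀-moves w j s v

  R-moves : ∀ w j s → Valid (w , j , s) → proj₁ (R j (w , s)) ≢ w
  R-moves w j s v with slot? (w , j , s)
  ... | yes (k , refl) = rows-differ k
  ... | no _ = R₀-moves w j s v

  -- Every rotation is a single cycle after the replacement.

  -- Induction along the cycle from block 2 upwards, passing over v.
  sweep : (v : J) (P : J → Set) →
    (∀ i b → π (not b) (suc (suc (suc i)) , b) ≢ v →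
      P (π (not b) (suc (suc (suc i)) , b)) → P (suc (suc (suc i)) , b)) →
    (∀ i b → π (not b) (suc (suc (suc i)) , b) ≡ v → P (π b v) → P (suc (suc (suc i)) , b)) →
    (∀ b → (suc (suc zero) , b) ≢ v → P (suc (suc zero) , b)) →
    ∀ i b → (suc (suc i) , b) ≢ v → P (suc (suc i) , b)
  sweep v P walk skip start = <-weakInduction Q start λ i q → λ where
      false _ → first i q
      true  _ → second i q (first i q)
    where
    Q : Fin (suc m) → Set
    Q i = ∀ b → (suc (suc i) , b) ≢ v → P (suc (suc i) , b)

    first : ∀ i → Q (inject₁ i) → P (suc (suc (suc i)) , false)
    first i q with (suc (suc (inject₁ i)) , true) ≟J v
    ... | no ne   = walk i false ne (q true ne)
    ... | yes refl = skip i false refl (q false λ ())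

    second : ∀ i → Q (inject₁ i) → P (suc (suc (suc i)) , false) → P (suc (suc (suc i)) , true)
    second i q p with (suc (suc (suc i)) , false) ≟J v
    ... | no ne   = walk i true ne p
    ... | yes refl = skip i true refl (q true λ ())

  near : List J
  near = j₀ ∷ j₁ ∷ j₂ ∷ j₃ ∷ j₄ ∷ j₅ ∷ []

  open import Data.List.Membership.DecPropositional _≟J_ using () renaming (_∈?_ to _∈J?_)
  open import Data.List.Membership.DecPropositional _≟W_ using () renaming (_∈?_ to _∈W?_)

  covers? : (v : J) (l : List J) → Dec (All (λ j → j ≡ v ⊎ j ∈ l) near)
  covers? v l = all? (λ j → (j ≟J v) ⊎-dec (j ∈J? l)) near

  near-all : {P : J → Set} {v : J} → All (λ j → j ≢ v → P j) near →
             ((∀ b → (suc (suc zero) , b) ≢ v → P (suc (suc zero) , b)) →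
               ∀ i b → (suc (suc i) , b) ≢ v → P (suc (suc i) , b)) →
             ∀ j → j ≢ v → P j
  near-all (p₀ ∷ p₁ ∷ p₂ ∷ p₃ ∷ p₄ ∷ p₅ ∷ []) far = λ where
    j₀ → p₀
    j₁ → p₁
    j₂ → p₂
    j₃ → p₃
    (suc (suc i) , b) → far (λ { false → p₄ ; true → p₅ }) i b

  module Row (v : J) where
    open Walk (C (just v)) using (flip-joins; step-joins; module Chain)
    open Chain _≟J_

    -- The list settles columns 0 to 5 by evaluation. From column 6 on no new rectangle interferes,
    -- and the old rotation is followed downwards by `sweep`.
    joined : ∀ a as → {True (linked? hop? (a ∷ as))} → {True (covers? v (a ∷ as))} →
           ∃ λ x → ∀ j → just v ≢ just j → Joins (C (just v)) x j
    joined a as {l} {t} = (a , false) , λ j ne →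
        near-all {P} {v} (All.map [ contradiction , (λ k _ → lookup chain k) ]′ (toWitness t))
                 (sweep v P walk skip) j (ne ∘ cong just ∘ sym)
      where
      P : J → Set
      P = Joins (C (just v)) (a , false)

      chain : All P (a ∷ as)
      chain = chain-joins (toWitness l) (flip-joins false here)

      walk : ∀ i b → π (not b) (suc (suc (suc i)) , b) ≢ v →
        P (π (not b) (suc (suc (suc i)) , b)) → P (suc (suc (suc i)) , b)
      walk i b ne = step-joins (not b) (cong proj₁ (C₀-step v (suc (suc (suc i)) , b) (not b) ne))

      skip : ∀ i b → π (not b) (suc (suc (suc i)) , b) ≡ v → P (π b v) → P (suc (suc (suc i)) , b)
      skip i b eq p = step-joins (not b) (cong proj₁ (C₀-skip v (suc (suc (suc i)) , b) (not b) eq))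
        (subst (λ t → P (π t v)) (sym (Bool.not-involutive b)) p)

  C-joined : ∀ w → ∃ λ x → ∀ j → w ≢ just j → Joins (C w) x j
  C-joined (just v@j₀) = Row.joined v j₁ (j₂ ∷ j₃ ∷ j₄ ∷ j₅ ∷ [])
  C-joined (just v@j₁) = Row.joined v j₀ (j₂ ∷ j₃ ∷ j₄ ∷ j₅ ∷ [])
  C-joined (just v@j₂) = Row.joined v j₀ (j₁ ∷ j₃ ∷ j₄ ∷ j₅ ∷ [])
  C-joined (just v@j₃) = Row.joined v j₀ (j₁ ∷ j₂ ∷ j₄ ∷ j₅ ∷ [])
  -- Among the finite rows only row 4 changes its rotation: it trades the column pairs {0,1}, {2,3}
  -- for the pairs {0,2}, {1,3} formerly at ∞. Hence 2 precedes 1 here.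
  C-joined (just v@j₄) = Row.joined v j₀ (j₂ ∷ j₁ ∷ j₃ ∷ j₅ ∷ [])
  C-joined (just v@j₅) = Row.joined v j₄ (j₃ ∷ j₂ ∷ j₁ ∷ j₀ ∷ [])
  C-joined (just v@(suc (suc (suc _)) , _)) = Row.joined v j₀ (j₁ ∷ j₂ ∷ j₃ ∷ j₄ ∷ j₅ ∷ [])
  C-joined nothing = (j₄ , false) , λ where
      j₀ _ → step-joins false refl p₁
      j₁ _ → p₁
      j₂ _ → p₂
      j₃ _ → p₃
      (suc (suc i) , b) _ → far i b
    where
    open Walk (C nothing) using (flip-joins; step-joins)

    P : J → Set
    P = Joins (C nothing) (j₄ , false)

    p₄ : P j₄
    p₄ = flip-joins false here

    p₂ : P j₂
    p₂ = step-joins false refl p₄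

    p₃ : P j₃
    -- The face {∞,5}×{2,3} is the first bridge between the odd and the even columns.
    p₃ = step-joins false refl p₂

    far : ∀ i b → P (suc (suc i) , b)
    far = <-weakInduction (λ i → ∀ b → P (suc (suc i) , b))
      (λ { false → p₄ ; true → step-joins false refl p₃ })
      (λ { i q false → step-joins true refl (q false) ; i q true → step-joins false refl (q true) })

    p₁ : P j₁
    -- Column 1 steps back around the cycle to the last odd column, 2n - 1. Column 0 then hangs on
    -- column 1 through the other bridge, {∞,3}×{0,1}.
    p₁ = step-joins false refl (far (fromℕ m) true)

  -- No new rectangle uses a finite row beyond 5. The split on `v` is there because `corner?`
  -- inspects the column first.
  R-far : ∀ v i b s → R v (just (suc (suc (suc i)) , b) , s) ≡ R₀ v (just (suc (suc (suc i)) , b) , s)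
  R-far j₀ i b s = refl
  R-far j₁ i b s = refl
  R-far j₂ i b s = refl
  R-far j₃ i b s = refl
  R-far (suc (suc _) , _) i b s = refl

  module Column (v : J) where
    open Walk (R v) using (flip-joins; step-joins; module Chain)
    open Chain _≟W_

    joined : ∀ a as → {True (linked? hop? (a ∷ as))} →
           {True (all? (λ j → (j ≟J v) ⊎-dec (just j ∈W? (a ∷ as))) near)} →
           nothing ∈ (a ∷ as) ⊎ proj₁ (R v (nothing , false)) ≡ just (π false v) →
           ∃ λ x → ∀ w → w ≢ just v → Joins (R v) x w
    joined a as {l} {t} n = (a , false) , λ where
        (just j) ne → all j (ne ∘ cong just)
        nothing  _  → none n
      where
      P : W → Set
      P = Joins (R v) (a , false)

      chain : All P (a ∷ as)
      chain = chain-joins (toWitness l) (flip-joins false here)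

      walk : ∀ i b → π (not b) (suc (suc (suc i)) , b) ≢ v →
        P (just (π (not b) (suc (suc (suc i)) , b))) → P (just (suc (suc (suc i)) , b))
      walk i b ne = step-joins (not b) (cong proj₁
        (trans (R-far v i b (not b)) (R₀-step (suc (suc (suc i)) , b) v (not b) ne)))

      skip : ∀ i b → π (not b) (suc (suc (suc i)) , b) ≡ v →
        P (just (π b v)) → P (just (suc (suc (suc i)) , b))
      -- Unlike in a row, the gap at `v` is filled by `nothing`, so crossing it takes two steps.
      skip i b eq p = step-joins (not b) (cong proj₁
          (trans (R-far v i b (not b)) (R₀-skip (suc (suc (suc i)) , b) v (not b) eq)))
          (step-joins b (cong proj₁ (beyond b eq)) p)
        where
        -- The equation puts `v` in block 2 or later, outside the columns of the new rectangles.
        beyond : ∀ b → π (not b) (suc (suc (suc i)) , b) ≡ v → R v (nothing , b) ≡ (just (π b v) , b)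
        beyond false refl = refl
        beyond true  refl = refl

      all : ∀ j → j ≢ v → P (just j)
      all = near-all {λ j → P (just j)} {v}
        (All.map [ contradiction , (λ k _ → lookup chain k) ]′ (toWitness t))
        (sweep v (λ j → P (just j)) walk skip)

      none : nothing ∈ (a ∷ as) ⊎ proj₁ (R v (nothing , false)) ≡ just (π false v) → P nothing
      none (inj₁ k) = lookup chain k
      none (inj₂ e) = step-joins false e (all (π false v) (π-moves false v))

  R-joined : ∀ j → ∃ λ x → ∀ w → w ≢ just j → Joins (R j) x w
  R-joined v@j₀ = Column.joined v nothing
    (just j₃ ∷ just j₄ ∷ just j₁ ∷ just j₂ ∷ just j₅ ∷ []) (inj₁ (here refl))
  R-joined v@j₁ = Column.joined v (just j₀)
    (nothing ∷ just j₃ ∷ just j₄ ∷ just j₂ ∷ just j₅ ∷ []) (inj₁ (there (here refl)))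
  R-joined v@j₂ = Column.joined v (just j₀)
    (just j₁ ∷ just j₄ ∷ just j₃ ∷ nothing ∷ just j₅ ∷ []) (inj₁ (there (there (there (there (here refl))))))
  R-joined v@j₃ = Column.joined v (just j₀)
    (just j₁ ∷ just j₂ ∷ just j₄ ∷ nothing ∷ just j₅ ∷ []) (inj₁ (there (there (there (there (here refl))))))
  R-joined v@j₄ = Column.joined v (just j₀)
    (just j₁ ∷ just j₂ ∷ just j₃ ∷ nothing ∷ just j₅ ∷ []) (inj₂ refl)
  R-joined v@j₅ = Column.joined v (just j₀)
    (just j₁ ∷ just j₂ ∷ just j₃ ∷ just j₄ ∷ nothing ∷ []) (inj₂ refl)
  R-joined v@(suc (suc (suc _)) , _) = Column.joined v (just j₀)
    (just j₁ ∷ just j₂ ∷ just j₃ ∷ just j₄ ∷ just j₅ ∷ []) (inj₂ refl)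

  -- Assembly and the orientation-reversing walk.

  scheme : Scheme W J (λ w j → w ≢ just j)
  scheme = record
    { C = C
    ; R = R
    ; C-valid = PC.f-valid
    ; R-valid = PR.f-valid
    ; C-involutive = PC.f-involutive
    ; R-involutive = PR.f-involutive
    ; commute = commute
    ; C-moves = C-moves
    ; R-moves = R-moves
    ; C-joined = C-joined
    ; R-joined = R-joined
    }

  -- Here `(i , b)` is numbered b(3 + m) + i and not 2i + b. The rows are numbered through the same
  -- bijection, so the deleted matching is still the diagonal.
  black : J ↔ Fin (2 * (3 + m))
  black = ↔-trans (×-comm (Fin (3 + m)) Bool)
    (↔-sym (↔-trans (Fin.*↔× {2} {3 + m}) (Fin.2↔Bool ×-↔ ↔-refl)))

  open Realise black scheme using (embedding; quadrangular; nonorientable; Move; c; r; f)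

  nonorientable-quadrangulation :
    Σ (Embedding (2 * (3 + m) + 1) (2 * (3 + m)) (2 * (3 + m))) λ M → Quadrangular M × Nonorientable M
  nonorientable-quadrangulation = embedding , quadrangular ,
    -- Starting at cell (3,0), the walk runs through the faces {∞,3}×{0,1}, {3,4}×{1,2}, {1,4}×{0,2}
    -- and {3,4}×{0,2n-1}, each `f` crossing into the next and the last one back into the first:
    -- five moves inside faces and four crossings.
    nonorientable (c ∷ f ∷ c ∷ r ∷ f ∷ c ∷ f ∷ r ∷ f ∷ []) (just j₃ , j₀ , false) (λ ()) refl
      λ { false → refl ; true → refl }

theorem1 : (n : ℕ) → 3 ≤ n →
    Σ (Embedding (2 * n + 1) (2 * n) (2 * n)) λ M → Quadrangular M × Nonorientable M
theorem1 (suc (suc (suc m))) (s≤s (s≤s (s≤s z≤n))) = Construction.nonorientable-quadrangulation m
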